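{- Let $m \geq 3$ and $n \ge 6$ with $n \equiv 0 \pmod 6$. Then: (a) if $m \equiv 0 \pmod 3$, then $\gamma_{r2}(C_{m} \Box C_n) = \frac{m}{3}\, n$; (b) if $m \equiv 1 \pmod 3$, then $\left(\frac{m-1}{3} + \frac{1}{2}\right) n \le \gamma_{r2}(C_{m} \Box C_n) \le \frac{m+2}{3}\, n$; (c) if $m \equiv 2 \pmod 3$, then $\gamma_{r2}(C_{m} \Box C_n) = \frac{m+1}{3}\, n$.
   Context: For a graph $G$, a 2-rainbow dominating function (2RDF) is a function $f$ assigning to each vertex a subset of $\{1,2\}$ such that every vertex $v$ with $f(v)=\emptyset$ satisfies $\bigcup_{u\in N(v)} f(u)=\{1,2\}$, where $N(v)$ is the open neighborhood of $v$. Its weight is $w(f)=\sum_{v\in V(G)}|f(v)|$, and the 2-rainbow domination number $\gamma_{r2}(G)$ is the minimum weight of a 2RDF of $G$. $C_m \Box C_n$ denotes the Cartesian product of the cycles $C_m$ and $C_n$ (vertex set $V(C_m)\times V(C_n)$, two vertices adjacent iff equal in one coordinate and adjacent in the other). -}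

module Defs where

open import Data.Nat using (ℕ; zero; suc; _+_; _*_; _≤_; NonZero)
open import Data.Nat.DivMod using (_%_)
open import Data.Fin using (Fin; toℕ)
open import Data.Bool using (Bool; true; false; _∨_)
open import Data.Product using (_×_; _,_; ∃)
open import Data.Sum using (_⊎_)
open import Data.List using (List; map; allFin; cartesianProduct)
open import Data.Nat.ListAction using (sum)
open import Relation.Binary.PropositionalEquality using (_≡_)

CycAdj : (m : ℕ) → .{{_ : NonZero m}} → Fin m → Fin m → Set
CycAdj m i j = (toℕ j ≡ (suc (toℕ i)) % m) ⊎ (toℕ i ≡ (suc (toℕ j)) % m)

Vtx : ℕ → ℕ → Set
Vtx m n = Fin m × Fin n

Adj : (m n : ℕ) → .{{_ : NonZero m}} → .{{_ : NonZero n}} → Vtx m n → Vtx m n → Set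
Adj m n (a , b) (c , d) = (a ≡ c × CycAdj n b d) ⊎ (b ≡ d × CycAdj m a c)

-- A subset of {1,2} is encoded as a pair of booleans (1 ∈ S , 2 ∈ S).
Label : Set
Label = Bool × Bool

size : Label → ℕ
size (x , y) = b2n x + b2n y
  where
  b2n : Bool → ℕ
  b2n true = 1
  b2n false = 0

Is2RDF : (m n : ℕ) → .{{_ : NonZero m}} → .{{_ : NonZero n}} → (Vtx m n → Label) → Set
Is2RDF m n f = ∀ v → f v ≡ (false , false) →
  (∃ λ u → Adj m n v u × Data.Product.proj₁ (f u) ≡ true) ×
  (∃ λ u → Adj m n v u × Data.Product.proj₂ (f u) ≡ true)

weight : (m n : ℕ) → (Vtx m n → Label) → ℕ
weight m n f = sum (map (λ v → size (f v)) (cartesianProduct (allFin m) (allFin n)))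

IsγR2 : (m n : ℕ) → .{{_ : NonZero m}} → .{{_ : NonZero n}} → ℕ → Set
IsγR2 m n k =
  (∃ λ f → Is2RDF m n f × weight m n f ≡ k) ×
  (∀ f → Is2RDF m n f → k ≤ weight m n f)

{-# OPTIONS --safe #-}
module Submission where

-- Lower bound: at every vertex v, 2|f(v)| plus the weights of the four neighbours is at least 2.
-- Summing over the j-th copy of C_m, of weight w_j, gives 2m ≤ 4 w_j + w_{j-1} + w_{j+1}.
-- If moreover 6c ≤ 2mq + 2, then every x_j = q w_j below c is compensated by its two neighbours,
-- so that the x_j have average at least c.  Take (q , c) = (1 , m/3), (2 , (2m+1)/3), (1 , (m+1)/3)
-- for m ≡ 0, 1, 2 (mod 3).
--
-- Upper bound: for 3 ∣ m a perfect pattern on C_3 □ C_6 lifts along the covering C_m □ C_n → C_3 □ C_6.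
-- Contracting an edge of C_m and taking unions of the merged labels does not increase the weight,
-- so the other residues inherit the bound from the next multiple of 3.

open import Defs
open import Data.Nat using (ℕ; suc; _+_; _*_; _≤_; _∸_; NonZero)
open import Data.Nat.DivMod using (_%_)
open import Data.Product using (_×_; ∃)
open import Relation.Binary.PropositionalEquality using (_≡_)

open import Data.Nat.Properties
open import Algebra.Properties.CommutativeMonoid.Sum +-0-commutativeMonoid
  using (sum; sum-cong-≗; sum-init-last; ∑-distrib-+; ∑-comm)
open import Data.Bool using (Bool; true; false; _∨_; not; if_then_else_)
open import Data.Bool.Properties using (∨-zeroʳ) renaming (_≟_ to _≟ᵇ_)
open import Data.Fin using (Fin; zero; suc; toℕ; fromℕ; inject₁; pinch; combine; remQuot; funToFin; finToFun)
open import Data.Fin.Properties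
  using (toℕ<n; toℕ-injective; toℕ-fromℕ; toℕ-fromℕ<; toℕ-inject₁; all?; any?; remQuot-combine; *↔×; 2↔Bool; finToFun-funToFin)
  renaming (_≟_ to _≟ᶠ_)
import Data.List as List
open import Data.List.Extrema ≤-totalOrder using (argmin; argmin-all; f[argmin]≤f[xs])
open import Data.List.Membership.Propositional.Properties using (∈-map⁺; ∈-filter⁺; ∈-allFin)
open import Data.List.Properties using (map-tabulate; map-++; map-∘; map-cong)
import Data.List.Relation.Unary.All as All
open import Data.List.Relation.Unary.All.Properties using (all-filter)
open import Data.Nat using (zero; _<_; z≤n; s≤s; s≤s⁻¹; _≡ᵇ_; _^_) renaming (_≟_ to _≟ⁿ_)
open import Data.Nat.Divisibility using (_∣_; divides; m%n≡0⇒n∣m)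
open import Data.Nat.DivMod
  using (_/_; _mod_; m%n<n; m<n⇒m%n≡m; n%n≡0; m%n%n≡m%n; %-distribˡ-+; m∣n⇒o%n%m≡o%m; m≡m%n+[m/n]*n; [m+n]%n≡m%n)
open import Data.Nat.ListAction using () renaming (sum to sumˡ)
open import Data.Nat.ListAction.Properties using (sum-++)
open import Data.Nat.Tactic.RingSolver using (solve-∀)
open import Data.Product using (_,_; proj₁; proj₂; uncurry)
open import Data.Product.Function.NonDependent.Propositional using (_×-↔_)
open import Data.Product.Properties using (≡-dec)
open import Data.Sum using (_⊎_; inj₁; inj₂; [_,_]′; map; map₂)
open import Function using (_∘_; _↔_; Inverse)
open import Function.Construct.Composition using (_↔-∘_)
open import Relation.Binary.PropositionalEquality using (refl; sym; trans; cong; cong₂; subst; _≗_; module ≡-Reasoning)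
open import Relation.Nullary using (Dec; contradiction)
open import Relation.Nullary.Decidable using (map′; _×-dec_; _⊎-dec_; _→-dec_; toWitness)

-- Finite sums.

sum-mono : ∀ {n} {s t : Fin n → ℕ} → (∀ i → s i ≤ t i) → sum s ≤ sum t
sum-mono {zero}  s≤t = z≤n
sum-mono {suc n} s≤t = +-mono-≤ (s≤t zero) (sum-mono (s≤t ∘ suc))

sum-const : ∀ n c → sum {n} (λ _ → c) ≡ n * c
sum-const zero    c = refl
sum-const (suc n) c = cong (c +_) (sum-const n c)

sum-scale : ∀ {n} c (t : Fin n → ℕ) → sum (λ i → c * t i) ≡ c * sum t
sum-scale {zero}  c t = sym (*-zeroʳ c)
sum-scale {suc n} c t = trans (cong (c * t zero +_) (sum-scale c (t ∘ suc))) (sym (*-distribˡ-+ c (t zero) _))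

sum-period-3 : ∀ k (g : ℕ → ℕ) → (∀ a → g (3 + a) ≡ g a) →
               sum {k * 3} (g ∘ toℕ) ≡ k * sum {3} (g ∘ toℕ)
sum-period-3 zero    g per = refl
sum-period-3 (suc k) g per = begin
  g 0 + (g 1 + (g 2 + sum {k * 3} (λ i → g (3 + toℕ i)))) ≡⟨ cong (λ s → g 0 + (g 1 + (g 2 + s))) (sum-cong-≗ {k * 3} (λ i → per (toℕ i))) ⟩
  g 0 + (g 1 + (g 2 + sum {k * 3} (g ∘ toℕ)))             ≡⟨ cong (λ s → g 0 + (g 1 + (g 2 + s))) (sum-period-3 k g per) ⟩
  g 0 + (g 1 + (g 2 + k * sum {3} (g ∘ toℕ)))             ≡⟨ assoc₄ (g 0) (g 1) (g 2) _ ⟩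
  suc k * sum {3} (g ∘ toℕ)                               ∎
  where
  open ≡-Reasoning
  assoc₄ : ∀ a b c d → a + (b + (c + d)) ≡ a + (b + (c + 0)) + d
  assoc₄ = solve-∀

-- Arithmetic of a cycle

Succ : ∀ m → .{{_ : NonZero m}} → Fin m → Fin m → Set
Succ m i j = toℕ j ≡ suc (toℕ i) % m

succ-cases : ∀ {m} .{{_ : NonZero m}} (i j : Fin m) → Succ m i j →
             (suc (toℕ i) < m × toℕ j ≡ suc (toℕ i)) ⊎ (suc (toℕ i) ≡ m × toℕ j ≡ 0)
succ-cases {m} i j i→j with m≤n⇒m<n∨m≡n (toℕ<n i)
... | inj₁ i<   = inj₁ (i< , trans i→j (m<n⇒m%n≡m i<))
... | inj₂ i≡   = inj₂ (i≡ , trans i→j (trans (cong (_% m) i≡) (n%n≡0 m)))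

next : ∀ {m} .{{_ : NonZero m}} → Fin m → Fin m
next {m} i = suc (toℕ i) mod m

succ-next : ∀ {m} .{{_ : NonZero m}} (i : Fin m) → Succ m i (next i)
succ-next {m} i = toℕ-fromℕ< (m%n<n (suc (toℕ i)) m)

succ⇒next : ∀ {m} .{{_ : NonZero m}} (i j : Fin m) → Succ m i j → j ≡ next i
succ⇒next i j i→j = toℕ-injective (trans i→j (sym (succ-next i)))

-- Defined by cases rather than as addition of `m - 1` modulo `m`, so that reindexing a sum along it
-- just moves the last term to the front.
prev : ∀ {m} → Fin m → Fin m
prev {suc m} zero    = fromℕ m
prev {suc m} (suc i) = inject₁ i

succ-prev : ∀ {m} .{{_ : NonZero m}} (j : Fin m) → Succ m (prev j) j
succ-prev {suc m} zero rewrite toℕ-fromℕ m = sym (n%n≡0 (suc m))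
succ-prev {suc m} (suc i) rewrite toℕ-inject₁ i = sym (m<n⇒m%n≡m (s≤s (toℕ<n i)))

succ⇒prev : ∀ {m} .{{_ : NonZero m}} (i j : Fin m) → Succ m i j → i ≡ prev j
succ⇒prev {suc m} i j i→j with j | succ-cases i j i→j
... | zero  | inj₂ (i≡ , _) = toℕ-injective (trans (suc-injective i≡) (sym (toℕ-fromℕ m)))
... | suc k | inj₁ (_ , k≡) = toℕ-injective (trans (sym (suc-injective k≡)) (sym (toℕ-inject₁ k)))

cycAdj-cases : ∀ {m} .{{_ : NonZero m}} (i j : Fin m) → CycAdj m i j → j ≡ next i ⊎ j ≡ prev i
cycAdj-cases i j (inj₁ i→j) = inj₁ (succ⇒next i j i→j)
cycAdj-cases i j (inj₂ j→i) = inj₂ (succ⇒prev j i j→i)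

sum-prev : ∀ {m} (t : Fin m → ℕ) → sum (t ∘ prev) ≡ sum t
sum-prev {zero}  t = refl
sum-prev {suc m} t = trans (+-comm (t (fromℕ m)) _) (sym (sum-init-last t))

-- Since `next (prev j) ≡ j`, this follows by reindexing `t ∘ next` along `prev`.
sum-next : ∀ {m} .{{_ : NonZero m}} (t : Fin m → ℕ) → sum (t ∘ next) ≡ sum t
sum-next {m} t = trans (sym (sum-prev (t ∘ next)))
  (sum-cong-≗ {m} (λ j → cong t (sym (succ⇒next (prev j) j (succ-prev j)))))

-- Averaging around a cycle.

-- If `x` falls short of `c` by `e ≥ 1`, replacing `y` and `z` by `c` plus their surpluses leaves a
-- total surplus of at least `4e - 2`, and integrality gives `4e - 2 ≥ 2e`. This is what makes the
-- slack `+ 2` in the hypothesis affordable.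
deficit≤surplus : ∀ c x y z → 6 * c ≤ 4 * x + y + z + 2 → 2 * (c ∸ x) ≤ (y ∸ c) + (z ∸ c)
deficit≤surplus c x y z h with <-≤-connex x c
... | inj₂ c≤x rewrite m≤n⇒m∸n≡0 c≤x = z≤n
... | inj₁ x<c with m≤n⇒∃[o]m+o≡n x<c
...   | d , refl = subst (λ q → 2 * q ≤ p + r) (sym c∸x) (≤-trans 2+2d≤ 2+4d≤)
  where
  p = y ∸ suc (x + d)
  r = z ∸ suc (x + d)
  c∸x : suc (x + d) ∸ x ≡ suc d
  c∸x = trans (cong (_∸ x) (sym (+-suc x d))) (m+n∸m≡n x (suc d))
  lhs : ∀ x d → 6 * suc (x + d) ≡ (6 * x + 2 * d + 4) + (2 + 4 * d)
  lhs = solve-∀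
  rhs : ∀ x d p r → 4 * x + (suc (x + d) + p) + (suc (x + d) + r) + 2 ≡ (6 * x + 2 * d + 4) + (p + r)
  rhs = solve-∀
  2+4d≤ : 2 + 4 * d ≤ p + r
  2+4d≤ = +-cancelˡ-≤ (6 * x + 2 * d + 4) _ _ (begin
    (6 * x + 2 * d + 4) + (2 + 4 * d)                     ≡⟨ lhs x d ⟨
    6 * suc (x + d)                                       ≤⟨ h ⟩
    4 * x + y + z + 2                                     ≤⟨ +-monoˡ-≤ 2 (+-mono-≤ (+-monoʳ-≤ (4 * x) (m≤n+m∸n y (suc (x + d)))) (m≤n+m∸n z (suc (x + d)))) ⟩
    4 * x + (suc (x + d) + p) + (suc (x + d) + r) + 2     ≡⟨ rhs x d p r ⟩
    (6 * x + 2 * d + 4) + (p + r)                         ∎)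
    where open ≤-Reasoning
  2+2d≤ : 2 * suc d ≤ 2 + 4 * d
  2+2d≤ = ≤-trans (≤-reflexive (*-suc 2 d)) (+-monoʳ-≤ 2 (*-monoˡ-≤ d {2} {4} (s≤s (s≤s z≤n))))

-- Both sides are the maximum of `a` and `b`.
a+[b∸a]≡b+[a∸b] : ∀ a b → a + (b ∸ a) ≡ b + (a ∸ b)
a+[b∸a]≡b+[a∸b] zero    b       = sym (trans (cong (b +_) (0∸n≡0 b)) (+-identityʳ b))
a+[b∸a]≡b+[a∸b] (suc a) zero    = +-identityʳ (suc a)
a+[b∸a]≡b+[a∸b] (suc a) (suc b) = cong suc (a+[b∸a]≡b+[a∸b] a b)

-- Each i with x i < c takes half of the surplus of its two neighbours, which covers its deficit.
cyclic-average : ∀ {n} .{{_ : NonZero n}} c (x : Fin n → ℕ) →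
  (∀ i → 6 * c ≤ 4 * x i + x (next i) + x (prev i) + 2) → n * c ≤ sum x
cyclic-average {n} c x h = +-cancelʳ-≤ P (n * c) (sum x) (begin
  n * c + P                     ≡⟨ cong (_+ P) (sum-const n c) ⟨
  sum {n} (λ _ → c) + P         ≡⟨ ∑-distrib-+ {n} (λ _ → c) p ⟨
  sum (λ i → c + p i)           ≡⟨ sum-cong-≗ {n} (λ i → a+[b∸a]≡b+[a∸b] c (x i)) ⟩
  sum (λ i → x i + q i)         ≡⟨ ∑-distrib-+ x q ⟩
  sum x + Q                     ≤⟨ +-monoʳ-≤ (sum x) Q≤P ⟩
  sum x + P                     ∎)
  where
  open ≤-Reasoning
  p q : Fin n → ℕ
  p i = x i ∸ c
  q i = c ∸ x i
  P = sum p
  Q = sum q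
  2Q≤2P : 2 * Q ≤ 2 * P
  2Q≤2P = begin
    2 * Q                                ≡⟨ sum-scale 2 q ⟨
    sum (λ i → 2 * q i)                  ≤⟨ sum-mono (λ i → deficit≤surplus c (x i) _ _ (h i)) ⟩
    sum (λ i → p (next i) + p (prev i))  ≡⟨ ∑-distrib-+ (p ∘ next) (p ∘ prev) ⟩
    sum (p ∘ next) + sum (p ∘ prev)      ≡⟨ cong₂ _+_ (sum-next p) (trans (sum-prev p) (sym (+-identityʳ P))) ⟩
    2 * P                                ∎
  Q≤P : Q ≤ P
  Q≤P = *-cancelˡ-≤ 2 2Q≤2P

-- The weight as an iterated sum.

-- A global copy of the indicator local to `size`, so that the two colours can be counted
-- separately.
bit : Bool → ℕ
bit true  = 1
bit false = 0

size≡bits : ∀ l → size l ≡ bit (proj₁ l) + bit (proj₂ l)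
size≡bits (true  , true)  = refl
size≡bits (true  , false) = refl
size≡bits (false , true)  = refl
size≡bits (false , false) = refl

weight≡∑∑ : ∀ m n f → weight m n f ≡ sum {m} (λ i → sum {n} (λ j → size (f (i , j))))
weight≡∑∑ m n f = go m (λ i → i)
  where
  open ≡-Reasoning
  sumˡ-tabulate : ∀ {k} (t : Fin k → ℕ) → sumˡ (List.tabulate t) ≡ sum t
  sumˡ-tabulate {zero}  t = refl
  sumˡ-tabulate {suc k} t = cong (t zero +_) (sumˡ-tabulate (t ∘ suc))
  row : Fin m → List.List (Vtx m n)
  row i = List.map (i ,_) (List.allFin n)
  sum-row : ∀ i → sumˡ (List.map (size ∘ f) (row i)) ≡ sum {n} (λ j → size (f (i , j)))
  sum-row i = begin
    sumˡ (List.map (size ∘ f) (row i))                    ≡⟨ cong sumˡ (map-∘ (List.allFin n)) ⟨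
    sumˡ (List.map (size ∘ f ∘ (i ,_)) (List.allFin n))   ≡⟨ cong sumˡ (map-tabulate (λ j → j) (size ∘ f ∘ (i ,_))) ⟩
    sumˡ (List.tabulate (size ∘ f ∘ (i ,_)))              ≡⟨ sumˡ-tabulate (size ∘ f ∘ (i ,_)) ⟩
    sum (size ∘ f ∘ (i ,_))                               ∎
  -- The induction runs over an arbitrary family `is` of rows, because the tail of `allFin m` is a
  -- `tabulate` but not itself an `allFin`.
  go : ∀ k (is : Fin k → Fin m) →
       sumˡ (List.map (size ∘ f) (List.cartesianProduct (List.tabulate is) (List.allFin n))) ≡
       sum (λ i → sum {n} (λ j → size (f (is i , j))))
  go zero    is = refl
  go (suc k) is = begin
    sumˡ (List.map (size ∘ f) (row (is zero) List.++ rest))                          ≡⟨ cong sumˡ (map-++ (size ∘ f) (row (is zero)) rest) ⟩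
    sumˡ (List.map (size ∘ f) (row (is zero)) List.++ List.map (size ∘ f) rest)      ≡⟨ sum-++ (List.map (size ∘ f) (row (is zero))) _ ⟩
    sumˡ (List.map (size ∘ f) (row (is zero))) + sumˡ (List.map (size ∘ f) rest)     ≡⟨ cong₂ _+_ (sum-row (is zero)) (go k (is ∘ suc)) ⟩
    sum (λ i → sum {n} (λ j → size (f (is i , j))))                                  ∎
    where rest = List.cartesianProduct (List.tabulate (is ∘ suc)) (List.allFin n)

-- Lower bound

module _ {m n : ℕ} .{{_ : NonZero m}} .{{_ : NonZero n}} (f : Vtx m n → Label) (rdf : Is2RDF m n f) where

  private
    s : Fin m → Fin n → ℕ
    s i j = size (f (i , j))

    w : Fin n → ℕ
    w j = sum (λ i → s i j)

    -- Four slots instead of a set of neighbours: each slot is a cyclic shift, which `sum-next` and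
    -- `sum-prev` can sum.
    around : (Vtx m n → ℕ) → Fin m → Fin n → ℕ
    around t i j = t (next i , j) + t (prev i , j) + (t (i , next j) + t (i , prev j))

    around-≥1 : ∀ (c : Label → Bool) i j → (∃ λ u → Adj m n (i , j) u × c (f u) ≡ true) →
                1 ≤ around (bit ∘ c ∘ f) i j
    around-≥1 c i j ((a , b) , inj₁ (refl , adj) , cu) with cycAdj-cases j b adj
    ... | inj₁ refl rewrite cu = m≤n⇒m≤o+n (bit (c (f (next i , j))) + bit (c (f (prev i , j)))) (m≤m+n 1 _)
    ... | inj₂ refl rewrite cu = m≤n⇒m≤o+n (bit (c (f (next i , j))) + bit (c (f (prev i , j)))) (m≤n+m 1 (bit (c (f (i , next j)))))
    around-≥1 c i j ((a , b) , inj₂ (refl , adj) , cu) with cycAdj-cases i a adj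
    ... | inj₁ refl rewrite cu = s≤s z≤n
    ... | inj₂ refl rewrite cu = m≤n⇒m≤n+o _ (m≤n+m 1 (bit (c (f (next i , j)))))

    -- An empty vertex must see each colour, so the weight around it is split by colour and
    -- `around-≥1` is applied to each part.
    around-size : ∀ i j → around (size ∘ f) i j ≡ around (bit ∘ proj₁ ∘ f) i j + around (bit ∘ proj₂ ∘ f) i j
    around-size i j
      rewrite size≡bits (f (next i , j)) | size≡bits (f (prev i , j)) | size≡bits (f (i , next j)) | size≡bits (f (i , prev j))
      = regroup (bit (proj₁ (f (next i , j)))) _ (bit (proj₁ (f (prev i , j)))) _ (bit (proj₁ (f (i , next j)))) _ (bit (proj₁ (f (i , prev j)))) _
      where
      regroup : ∀ a a′ b b′ c c′ d d′ →
                (a + a′) + (b + b′) + ((c + c′) + (d + d′)) ≡ (a + b + (c + d)) + (a′ + b′ + (c′ + d′))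
      regroup = solve-∀

    local : ∀ i j → 2 ≤ 2 * s i j + around (size ∘ f) i j
    local i j with f (i , j) in fv
    ... | true  , true  = s≤s (s≤s z≤n)
    ... | true  , false = s≤s (s≤s z≤n)
    ... | false , true  = s≤s (s≤s z≤n)
    ... | false , false rewrite around-size i j =
      +-mono-≤ (around-≥1 proj₁ i j (proj₁ (rdf (i , j) fv))) (around-≥1 proj₂ i j (proj₂ (rdf (i , j) fv)))

  -- In the sum of `local` over the column, the two neighbours inside the column are shifts and
  -- contribute `w j` each; with the doubled own label this makes the coefficient 4.
  column-inequality : ∀ j → 2 * m ≤ 4 * w j + w (next j) + w (prev j)
  column-inequality j = begin
    2 * m                                                                                    ≡⟨ *-comm 2 m ⟩
    m * 2                                                                                    ≡⟨ sum-const m 2 ⟨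
    sum {m} (λ _ → 2)                                                                        ≤⟨ sum-mono (λ i → local i j) ⟩
    sum (λ i → 2 * s i j + around (size ∘ f) i j)                                            ≡⟨ ∑-distrib-+ (λ i → 2 * s i j) _ ⟩
    sum (λ i → 2 * s i j) + sum (λ i → around (size ∘ f) i j)                                ≡⟨ cong₂ _+_ (sum-scale 2 (λ i → s i j)) (∑-distrib-+ (λ i → s (next i) j + s (prev i) j) _) ⟩
    2 * w j + (sum (λ i → s (next i) j + s (prev i) j) + sum (λ i → s i (next j) + s i (prev j)))
      ≡⟨ cong (2 * w j +_) (cong₂ _+_
           (trans (∑-distrib-+ (λ i → s (next i) j) _) (cong₂ _+_ (sum-next (λ i → s i j)) (sum-prev (λ i → s i j))))
           (∑-distrib-+ (λ i → s i (next j)) _)) ⟩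
    2 * w j + ((w j + w j) + (w (next j) + w (prev j)))                                      ≡⟨ collect (w j) _ _ ⟩
    4 * w j + w (next j) + w (prev j)                                                        ∎
    where
    open ≤-Reasoning
    collect : ∀ a b c → 2 * a + ((a + a) + (b + c)) ≡ 4 * a + b + c
    collect = solve-∀

  -- Scaling by `q` comes before the averaging, so that the integer `c` can encode a fractional
  -- column average `c / q`; `q = 2` yields the half in the case of residue 1.
  weight-lower : ∀ q c → 6 * c ≤ q * (2 * m) + 2 → n * c ≤ q * weight m n f
  weight-lower q c h = begin
    n * c                ≤⟨ cyclic-average c (λ j → q * w j) (λ j → ≤-trans h (+-monoˡ-≤ 2 (scaled j))) ⟩
    sum (λ j → q * w j)  ≡⟨ sum-scale q w ⟩
    q * sum w            ≡⟨ cong (q *_) (trans (∑-comm {n} {m} (λ j i → s i j)) (sym (weight≡∑∑ m n f))) ⟩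
    q * weight m n f     ∎
    where
    open ≤-Reasoning
    distrib : ∀ q a b c → q * (4 * a + b + c) ≡ 4 * (q * a) + q * b + q * c
    distrib = solve-∀
    scaled : ∀ j → q * (2 * m) ≤ 4 * (q * w j) + q * w (next j) + q * w (prev j)
    scaled j = ≤-trans (*-monoʳ-≤ q (column-inequality j)) (≤-reflexive (distrib q (w j) _ _))

-- Coverings of a cycle by a longer one

-- Because `d ∣ m`, reducing modulo `m` does not disturb residues modulo `d`, so the wrap-around
-- step of the long cycle maps to a step of the short one.
succ-mod : ∀ {m} d .{{_ : NonZero m}} .{{_ : NonZero d}} → d ∣ m → (i j : Fin m) →
           Succ m i j → Succ d (toℕ i mod d) (toℕ j mod d)
succ-mod {m} d d∣m i j i→j = begin
  toℕ (toℕ j mod d)              ≡⟨ toℕ-mod (toℕ j) ⟩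
  toℕ j % d                      ≡⟨ cong (_% d) i→j ⟩
  suc (toℕ i) % m % d            ≡⟨ m∣n⇒o%n%m≡o%m d m _ d∣m ⟩
  suc (toℕ i) % d                ≡⟨ %-distribˡ-+ 1 (toℕ i) d ⟩
  (1 % d + toℕ i % d) % d        ≡⟨ cong (λ a → (1 % d + a) % d) (m%n%n≡m%n (toℕ i) d) ⟨
  (1 % d + toℕ i % d % d) % d    ≡⟨ %-distribˡ-+ 1 (toℕ i % d) d ⟨
  suc (toℕ i % d) % d            ≡⟨ cong (λ a → suc a % d) (toℕ-mod (toℕ i)) ⟨
  suc (toℕ (toℕ i mod d)) % d    ∎
  where
  open ≡-Reasoning
  toℕ-mod : ∀ a → toℕ (a mod d) ≡ a % d
  toℕ-mod a = toℕ-fromℕ< (m%n<n a d)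

-- The covering commutes with successor, and successors and predecessors are unique, so `next i` or
-- `prev i` must lie over `z`.
lift-adj : ∀ {m} d .{{_ : NonZero m}} .{{_ : NonZero d}} → d ∣ m → (i : Fin m) (z : Fin d) →
           CycAdj d (toℕ i mod d) z → ∃ λ j → CycAdj m i j × toℕ j mod d ≡ z
lift-adj d d∣m i z (inj₁ i→z) =
  next i , inj₁ (succ-next i) ,
  trans (succ⇒next _ _ (succ-mod d d∣m i (next i) (succ-next i))) (sym (succ⇒next _ _ i→z))
lift-adj d d∣m i z (inj₂ z→i) =
  prev i , inj₂ (succ-prev i) ,
  trans (succ⇒prev _ _ (succ-mod d d∣m (prev i) i (succ-prev i))) (sym (succ⇒prev _ _ z→i))

-- The pattern on C_3 □ C_6 and its lift.

-- Serves twice: to verify `tile` by evaluation, and to filter the candidates for the minimum.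
is2RDF? : ∀ m n .{{_ : NonZero m}} .{{_ : NonZero n}} f → Dec (Is2RDF m n f)
is2RDF? m n f = map′ uncurry (λ h i j → h (i , j)) (all? λ i → all? λ j →
  ≡-dec _≟ᵇ_ _≟ᵇ_ (f (i , j)) (false , false) →-dec
  (neighbour? (i , j) proj₁ ×-dec neighbour? (i , j) proj₂))
  where
  cycAdj? : ∀ k .{{_ : NonZero k}} (a b : Fin k) → Dec (CycAdj k a b)
  cycAdj? k a b = (toℕ b ≟ⁿ suc (toℕ a) % k) ⊎-dec (toℕ a ≟ⁿ suc (toℕ b) % k)
  adj? : ∀ v u → Dec (Adj m n v u)
  adj? (a , b) (c , d) = (a ≟ᶠ c ×-dec cycAdj? n b d) ⊎-dec (b ≟ᶠ d ×-dec cycAdj? m a c)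
  neighbour? : ∀ v (c : Label → Bool) → Dec (∃ λ u → Adj m n v u × c (f u) ≡ true)
  neighbour? v c = map′ (λ (a , b , h) → (a , b) , h) (λ ((a , b) , h) → a , b , h)
    (any? λ a → any? λ b → adj? v (a , b) ×-dec (c (f (a , b)) ≟ᵇ true))

-- The perfect pattern: the diagonals x + y ≡ 0 (mod 3), coloured alternately.
tile : Vtx 3 6 → Label
tile (x , y) = if (toℕ x + toℕ y) % 3 ≡ᵇ 0
  then (let even = toℕ y % 2 ≡ᵇ 0 in even , not even)
  else (false , false)

-- An empty vertex has exactly two neighbours on the diagonals, one in its own column and one in an
-- adjacent column. The parities of these columns differ (6 is even, so also across the
-- wrap-around), hence so do the colours.
tile-2RDF : Is2RDF 3 6 tile
tile-2RDF = toWitness {a? = is2RDF? 3 6 tile} _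

tile-column : ∀ y → sum {3} (λ x → size (tile (x , y))) ≡ 1
tile-column = toWitness {a? = all? λ y → sum {3} (λ x → size (tile (x , y))) ≟ⁿ 1} _

tiling : ∀ m n .{{_ : NonZero m}} .{{_ : NonZero n}} k → m ≡ k * 3 → n % 6 ≡ 0 →
         ∃ λ f → Is2RDF m n f × weight m n f ≤ k * n
tiling m n k refl 6∣n = f , rdf , ≤-reflexive (begin
  weight m n f                                                       ≡⟨ weight≡∑∑ m n f ⟩
  sum {m} (λ i → sum {n} (λ j → size (f (i , j))))                   ≡⟨ ∑-comm {m} {n} _ ⟩
  sum {n} (λ j → sum {m} (λ i → size (f (i , j))))                   ≡⟨ sum-cong-≗ {n} column ⟩
  sum {n} (λ _ → k)                                                  ≡⟨ sum-const n k ⟩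
  n * k                                                              ≡⟨ *-comm n k ⟩
  k * n                                                              ∎)
  where
  open ≡-Reasoning
  f : Vtx m n → Label
  f (i , j) = tile (toℕ i mod 3 , toℕ j mod 6)
  mod-shift : ∀ a → (3 + a) mod 3 ≡ a mod 3
  mod-shift a = toℕ-injective (trans (toℕ-fromℕ< (m%n<n (3 + a) 3))
    (trans (trans (cong (_% 3) (+-comm 3 a)) ([m+n]%n≡m%n a 3)) (sym (toℕ-fromℕ< (m%n<n a 3)))))
  column : ∀ j → sum {m} (λ i → size (f (i , j))) ≡ k
  column j = trans
    (sum-period-3 k (λ a → size (tile (a mod 3 , toℕ j mod 6))) (λ a → cong (λ x → size (tile (x , toℕ j mod 6))) (mod-shift a)))
    (trans (cong (k *_) (tile-column (toℕ j mod 6))) (*-identityʳ k))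
  -- The lifted neighbour lies over the given one, so by the definition of `f` it carries the same
  -- label.
  lift : ∀ i j (c : Label → Bool) →
         (∃ λ u → Adj 3 6 (toℕ i mod 3 , toℕ j mod 6) u × c (tile u) ≡ true) →
         ∃ λ u → Adj m n (i , j) u × c (f u) ≡ true
  lift i j c ((a , b) , inj₁ (refl , adj) , cu) with lift-adj 6 (m%n≡0⇒n∣m n 6 6∣n) j b adj
  ... | b′ , adj′ , refl = (i , b′) , inj₁ (refl , adj′) , cu
  lift i j c ((a , b) , inj₂ (refl , adj) , cu) with lift-adj 3 (divides k refl) i a adj
  ... | a′ , adj′ , refl = (a′ , j) , inj₂ (refl , adj′) , cu
  rdf : Is2RDF m n f
  rdf (i , j) fv = lift i j proj₁ (proj₁ near) , lift i j proj₂ (proj₂ near)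
    where near = tile-2RDF (toℕ i mod 3 , toℕ j mod 6) fv

-- Contracting an edge of C_m

-- Only the edge from 0 to 1 collapses. Every other step starts at some `suc a` and becomes a step
-- from `a`, the wrap-around included.
succ-pinch : ∀ m (i j : Fin (suc (suc m))) → Succ (suc (suc m)) i j →
             pinch zero i ≡ pinch zero j ⊎ Succ (suc m) (pinch zero i) (pinch zero j)
succ-pinch m i j i→j with i | j | succ-cases i j i→j
... | zero  | suc zero    | _              = inj₁ refl
... | zero  | zero        | inj₁ (_ , ())
... | zero  | zero        | inj₂ (() , _)
... | zero  | suc (suc b) | inj₁ (_ , ())
... | zero  | suc (suc b) | inj₂ (() , _)
... | suc a | suc b       | inj₁ (a< , b≡) =
  inj₂ (trans (suc-injective b≡) (sym (m<n⇒m%n≡m (s≤s⁻¹ a<))))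
... | suc a | zero        | inj₂ (a≡ , _)  =
  inj₂ (sym (trans (cong (_% suc m) (suc-injective a≡)) (n%n≡0 (suc m))))

_∪_ : Label → Label → Label
(a , b) ∪ (c , d) = a ∨ c , b ∨ d

size-∪ : ∀ k l → size (k ∪ l) ≤ size k + size l
size-∪ k@(a , b) l@(c , d) rewrite size≡bits (k ∪ l) | size≡bits k | size≡bits l = begin
  bit (a ∨ c) + bit (b ∨ d)           ≤⟨ +-mono-≤ (bit-∨ a c) (bit-∨ b d) ⟩
  (bit a + bit c) + (bit b + bit d)   ≡⟨ interchange (bit a) (bit c) (bit b) (bit d) ⟩
  (bit a + bit b) + (bit c + bit d)   ∎
  where
  open ≤-Reasoning
  bit-∨ : ∀ x y → bit (x ∨ y) ≤ bit x + bit y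
  bit-∨ true  y = s≤s z≤n
  bit-∨ false y = ≤-refl
  interchange : ∀ w x y z → (w + x) + (y + z) ≡ (w + y) + (x + z)
  interchange = solve-∀

contract : ∀ m n .{{_ : NonZero n}} k →
           (∃ λ f → Is2RDF (suc (suc m)) n f × weight (suc (suc m)) n f ≤ k) →
           ∃ λ g → Is2RDF (suc m) n g × weight (suc m) n g ≤ k
contract m n k (f , rdf , f≤k) = g , g-2RDF , ≤-trans g≤f f≤k
  where
  g : Vtx (suc m) n → Label
  g (zero  , j) = f (zero , j) ∪ f (suc zero , j)
  g (suc i , j) = f (suc (suc i) , j)

  -- `suc i` serves as preimage of `i` under the contraction. For the merged vertex this is the
  -- endpoint 1, which is empty because the union is.
  f-empty : ∀ i j → g (i , j) ≡ (false , false) → f (suc i , j) ≡ (false , false)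
  f-empty (suc i) j gv = gv
  f-empty zero    j gv with f (zero , j) | f (suc zero , j) | gv
  ... | false , false | l | refl = refl

  -- `c` stands for either colour; all that matters is that membership turns unions into
  -- disjunctions.
  module _ (c : Label → Bool) (c-∅ : c (false , false) ≡ false) (c-∪ : ∀ k l → c (k ∪ l) ≡ c k ∨ c l) where

    f⊆g : ∀ i j → c (f (i , j)) ≡ true → c (g (pinch zero i , j)) ≡ true
    f⊆g zero          j cf = trans (c-∪ _ _) (cong (_∨ c (f (suc zero , j))) cf)
    f⊆g (suc zero)    j cf = trans (c-∪ _ _) (trans (cong (c (f (zero , j)) ∨_) cf) (∨-zeroʳ _))
    f⊆g (suc (suc i)) j cf = cf

    push : ∀ i j → g (i , j) ≡ (false , false) →
           (∃ λ u → Adj (suc (suc m)) n (suc i , j) u × c (f u) ≡ true) →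
           ∃ λ u → Adj (suc m) n (i , j) u × c (g u) ≡ true
    push i j gv ((a , b) , inj₁ (refl , adj) , cu) = (i , b) , inj₁ (refl , adj) , f⊆g a b cu
    push i j gv ((a , b) , inj₂ (refl , adj) , cu) = [ collapsed , kept ]′ (pinch-adj adj)
      where
      pinch-adj : CycAdj (suc (suc m)) (suc i) a → i ≡ pinch zero a ⊎ CycAdj (suc m) i (pinch zero a)
      pinch-adj (inj₁ i→a) = map₂ inj₁ (succ-pinch m (suc i) a i→a)
      pinch-adj (inj₂ a→i) = map sym inj₂ (succ-pinch m a (suc i) a→i)
      -- Here the coloured neighbour was merged into the vertex itself, whose label would then
      -- contain the colour and not be empty.
      collapsed : i ≡ pinch zero a → _
      collapsed refl = contradiction (trans (sym (f⊆g a b cu)) (trans (cong c gv) c-∅)) λ ()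
      kept : CycAdj (suc m) i (pinch zero a) → _
      kept adj′ = (pinch zero a , b) , inj₂ (refl , adj′) , f⊆g a b cu

  g-2RDF : Is2RDF (suc m) n g
  g-2RDF (i , j) gv =
    push proj₁ refl (λ _ _ → refl) i j gv (proj₁ near) ,
    push proj₂ refl (λ _ _ → refl) i j gv (proj₂ near)
    where near = rdf (suc i , j) (f-empty i j gv)

  g≤f : weight (suc m) n g ≤ weight (suc (suc m)) n f
  g≤f = begin
    weight (suc m) n g                                                ≡⟨ weight≡∑∑ (suc m) n g ⟩
    sum {n} (λ j → size (f (zero , j) ∪ f (suc zero , j))) + rest     ≤⟨ +-monoˡ-≤ rest (sum-mono (λ j → size-∪ (f (zero , j)) _)) ⟩
    sum {n} (λ j → size (f (zero , j)) + size (f (suc zero , j))) + rest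
      ≡⟨ cong (_+ rest) (∑-distrib-+ {n} (λ j → size (f (zero , j))) _) ⟩
    (row zero + row (suc zero)) + rest                                ≡⟨ +-assoc (row zero) _ rest ⟩
    row zero + (row (suc zero) + rest)                                ≡⟨ weight≡∑∑ (suc (suc m)) n f ⟨
    weight (suc (suc m)) n f                                          ∎
    where
    open ≤-Reasoning
    row : Fin (suc (suc m)) → ℕ
    row i = sum {n} (λ j → size (f (i , j)))
    rest = sum {m} (λ i → row (suc (suc i)))

-- Existence of the minimum

-- Coding labels by four numbers makes a labelling a function between `Fin` types, which `finToFun`
-- enumerates.
label↔ : Fin (2 * 2) ↔ Label
label↔ = (2↔Bool ×-↔ 2↔Bool) ↔-∘ *↔×

-- The 4^(mn) coded labellings exhaust all labellings only up to pointwise equality.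
minimum : ∀ m n .{{_ : NonZero m}} .{{_ : NonZero n}} → ∃ (IsγR2 m n)
minimum m n = weight m n best , (best , best-2RDF , refl) , best-≤
  where
  -- The default value for `argmin`; it is a 2RDF vacuously, having no empty vertex.
  full : Vtx m n → Label
  full _ = true , true

  decode : Fin ((2 * 2) ^ (m * n)) → Vtx m n → Label
  decode c (i , j) = Inverse.to label↔ (finToFun c (combine i j))

  encode : (Vtx m n → Label) → Fin ((2 * 2) ^ (m * n))
  encode f = funToFin (Inverse.from label↔ ∘ f ∘ remQuot n)

  decode-encode : ∀ f → decode (encode f) ≗ f
  decode-encode f (i , j) = begin
    Inverse.to label↔ (finToFun (encode f) (combine i j))                        ≡⟨ cong (Inverse.to label↔) (finToFun-funToFin (Inverse.from label↔ ∘ f ∘ remQuot n) (combine i j)) ⟩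
    Inverse.to label↔ (Inverse.from label↔ (f (remQuot n (combine i j))))        ≡⟨ Inverse.strictlyInverseˡ label↔ _ ⟩
    f (remQuot n (combine i j))                                                  ≡⟨ cong f (remQuot-combine i j) ⟩
    f (i , j)                                                                    ∎
    where open ≡-Reasoning

  2RDF-resp : ∀ {f g} → f ≗ g → Is2RDF m n f → Is2RDF m n g
  2RDF-resp f≗g rdf v gv with rdf v (trans (f≗g v) gv)
  ... | (u , adj , cu) , (u′ , adj′ , cu′) =
    (u  , adj  , trans (cong proj₁ (sym (f≗g u)))  cu) ,
    (u′ , adj′ , trans (cong proj₂ (sym (f≗g u′))) cu′)

  weight-cong : ∀ {f g} → f ≗ g → weight m n f ≡ weight m n g
  weight-cong f≗g = cong sumˡ (map-cong (cong size ∘ f≗g) (List.cartesianProduct (List.allFin m) (List.allFin n)))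

  codes : List.List (Fin ((2 * 2) ^ (m * n)))
  codes = List.allFin _

  candidates : List.List (Vtx m n → Label)
  candidates = List.filter (is2RDF? m n) (List.map decode codes)

  best : Vtx m n → Label
  best = argmin (weight m n) full candidates

  best-2RDF : Is2RDF m n best
  best-2RDF = argmin-all (weight m n) (λ _ ()) (all-filter (is2RDF? m n) (List.map decode codes))

  best-≤ : ∀ f → Is2RDF m n f → weight m n best ≤ weight m n f
  best-≤ f rdf = ≤-trans
    (All.lookup (f[argmin]≤f[xs] {f = weight m n} full candidates)
      (∈-filter⁺ (is2RDF? m n) (∈-map⁺ decode (∈-allFin (encode f))) (2RDF-resp (sym ∘ decode-encode f) rdf)))
    (≤-reflexive (weight-cong (decode-encode f)))

-- The bounds for each residue of m modulo 3.

module _ {m n γ : ℕ} .{{_ : NonZero m}} .{{_ : NonZero n}} (isγ : IsγR2 m n γ) where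

  γ-lower : ∀ q c → 6 * c ≤ q * (2 * m) + 2 → n * c ≤ q * γ
  γ-lower q c h =
    let (f , rdf , w≡γ) , _ = isγ
    in subst (λ w → n * c ≤ q * w) w≡γ (weight-lower f rdf q c h)

  γ-upper : ∀ k → (∃ λ f → Is2RDF m n f × weight m n f ≤ k) → γ ≤ k
  γ-upper k (f , rdf , f≤k) = ≤-trans (proj₂ isγ f rdf) f≤k

  γ-0mod3 : n % 6 ≡ 0 → ∀ k → m ≡ k * 3 → 3 * γ ≡ m * n
  γ-0mod3 6∣n k refl = trans
    (cong (3 *_) (≤-antisym (γ-upper (k * n) (tiling m n k refl 6∣n))
      (subst (_≤ γ) (*-comm n k) (subst (n * k ≤_) (*-identityˡ γ) (γ-lower 1 k (≤-trans (≤-reflexive (6k k)) (m≤m+n _ 2)))))))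
    (regroup k n)
    where
    6k : ∀ k → 6 * k ≡ 1 * (2 * (k * 3))
    6k = solve-∀
    regroup : ∀ k n → 3 * (k * n) ≡ k * 3 * n
    regroup = solve-∀

  γ-1mod3 : n % 6 ≡ 0 → ∀ k → m ≡ suc (k * 3) →
            ((2 * (m ∸ 1) + 3) * n ≤ 6 * γ) × (3 * γ ≤ (m + 2) * n)
  γ-1mod3 6∣n k refl = lower , upper
    where
    open ≤-Reasoning
    -- With `q = 2` and `m = 3k + 1` the choice `c = 2k + 1` meets the hypothesis of `γ-lower` with
    -- equality.
    12k+6 : ∀ k → 6 * (2 * k + 1) ≡ 2 * (2 * suc (k * 3)) + 2
    12k+6 = solve-∀
    regroup : ∀ k n → (2 * (k * 3) + 3) * n ≡ 3 * (n * (2 * k + 1))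
    regroup = solve-∀
    regroup′ : ∀ k n → 3 * (suc k * n) ≡ (suc (k * 3) + 2) * n
    regroup′ = solve-∀
    lower : (2 * (k * 3) + 3) * n ≤ 6 * γ
    lower = begin
      (2 * (k * 3) + 3) * n    ≡⟨ regroup k n ⟩
      3 * (n * (2 * k + 1))    ≤⟨ *-monoʳ-≤ 3 (γ-lower 2 (2 * k + 1) (≤-reflexive (12k+6 k))) ⟩
      3 * (2 * γ)              ≡⟨ *-assoc 3 2 γ ⟨
      6 * γ                    ∎
    upper : 3 * γ ≤ (suc (k * 3) + 2) * n
    upper = ≤-trans
      -- The tiling lives on a cycle of length `3(k + 1) = m + 2`, so two contractions are made.
      (*-monoʳ-≤ 3 (γ-upper _ (contract (k * 3) n _ (contract (suc (k * 3)) n _ (tiling _ n (suc k) refl 6∣n)))))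
      (≤-reflexive (regroup′ k n))

  γ-2mod3 : n % 6 ≡ 0 → ∀ k → m ≡ suc (suc (k * 3)) → 3 * γ ≡ (m + 1) * n
  γ-2mod3 6∣n k refl = trans
    (cong (3 *_) (≤-antisym (γ-upper _ (contract (suc (k * 3)) n _ (tiling _ n (suc k) refl 6∣n)))
      (subst (_≤ γ) (*-comm n (suc k)) (subst (n * suc k ≤_) (*-identityˡ γ) (γ-lower 1 (suc k) (≤-reflexive (6k+6 k)))))))
    (regroup k n)
    where
    -- Equality again: the slack 2 raises the column average from `m / 3` to `(m + 1) / 3`, which
    -- the contracted tiling attains.
    6k+6 : ∀ k → 6 * suc k ≡ 1 * (2 * suc (suc (k * 3))) + 2
    6k+6 = solve-∀
    regroup : ∀ k n → 3 * (suc k * n) ≡ (suc (suc (k * 3)) + 1) * n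
    regroup = solve-∀

theorem1 : (m n : ℕ) → .{{_ : NonZero m}} → .{{_ : NonZero n}} →
    3 ≤ m → 6 ≤ n → n % 6 ≡ 0 →
    ∃ λ γ → IsγR2 m n γ ×
    ((m % 3 ≡ 0 → 3 * γ ≡ m * n) ×
    (m % 3 ≡ 1 → ((2 * (m ∸ 1) + 3) * n ≤ 6 * γ) × (3 * γ ≤ (m + 2) * n)) ×
    (m % 3 ≡ 2 → 3 * γ ≡ (m + 1) * n))
theorem1 m n _ _ 6∣n = let γ , isγ = minimum m n in γ , isγ ,
  (λ r → γ-0mod3 isγ 6∣n (m / 3) (split r)) ,
  (λ r → γ-1mod3 isγ 6∣n (m / 3) (split r)) ,
  (λ r → γ-2mod3 isγ 6∣n (m / 3) (split r))
  where
  split : ∀ {r} → m % 3 ≡ r → m ≡ r + m / 3 * 3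
  split r = trans (m≡m%n+[m/n]*n m 3) (cong (_+ m / 3 * 3) r)
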